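{- Let $G$ be a finite simple undirected graph that is connected. Let $n$ be the number of vertices of $G$, $p$ the order of a longest path in $G$, and $c$ the order of a longest cycle in $G$. If $$\frac{1}{2}\sigma_2\ge \frac{p}{2},$$ then $c=p=n$.
   Context: All graphs are finite, undirected, without loops or multiple edges. The order of a path or cycle is its number of vertices. By convention a single vertex and a single edge are regarded as cycles of orders 1 and 2, respectively (so $c\ge 1$ always, and for instance $c=1$ for $K_1$ and $c=2$ for $K_2$). Let $\alpha$ be the independence number of $G$. If $\alpha\ge 2$, $\sigma_2$ denotes the minimum of $d(x)+d(y)$ over all pairs of distinct nonadjacent vertices $x,y$ of $G$; if $\alpha<2$, then $\sigma_2=+\infty$ (so the hypothesis on $\sigma_2$ holds automatically). -}

module Defs where

open import Data.Fin.Base using (Fin)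
open import Data.Fin.Subset using (Subset; _∈_; ∣_∣)
open import Data.Integer.Base using (+_)
open import Data.List.Base using (List; []; _∷_; _∷ʳ_; length; filter; allFin)
open import Data.List.Relation.Unary.Linked using (Linked)
open import Data.List.Relation.Unary.Unique.Propositional using (Unique)
open import Data.Nat.Base using (ℕ; _+_; _≤_; _<_)
open import Data.Product.Base using (∃; ∃₂; _×_)
open import Data.Rational.Unnormalised.Base as ℚᵘ using (ℚᵘ; _/_)
open import Level using (0ℓ)
open import Relation.Binary.Construct.Add.Supremum.NonStrict ℚᵘ._≤_ using () renaming (_≤⁺_ to _≤∞_) public
open import Relation.Binary.Construct.Closure.ReflexiveTransitive using (Star)
open import Relation.Binary.Core using (Rel)
open import Relation.Binary.Definitions using (Decidable; Irreflexive; Symmetric)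
open import Relation.Binary.PropositionalEquality.Core using (_≡_; _≢_)
open import Relation.Nullary.Construct.Add.Supremum using (_⁺; ⊤⁺; [_])
open import Relation.Nullary.Negation.Core using (¬_)
open import Relation.Unary using (Pred)

Greatest : Pred ℕ 0ℓ → Pred ℕ 0ℓ
Greatest P m = P m × (∀ {k} → P k → k ≤ m)

Least : Pred ℕ 0ℓ → Pred ℕ 0ℓ
Least P m = P m × (∀ {k} → P k → m ≤ k)

record Graph : Set₁ where
  field
    order  : ℕ
    Adj    : Rel (Fin order) 0ℓ
    adj?   : Decidable Adj
    sym    : Symmetric Adj
    irrefl : Irreflexive _≡_ Adj

  Vertex : Set
  Vertex = Fin order

module _ (G : Graph) where
  open Graph G

  -- The graph without vertices is not connected.
  Connected : Set
  Connected = 0 < order × (∀ x y → Star Adj x y)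

  degree : Vertex → ℕ
  degree x = length (filter (adj? x) (allFin order))

  data IsPath : Pred (List Vertex) 0ℓ where
    path : ∀ {x xs} → Unique (x ∷ xs) → Linked Adj (x ∷ xs) → IsPath (x ∷ xs)

  -- A single vertex and a single edge count as cycles of orders 1 and 2.
  data IsCycle : Pred (List Vertex) 0ℓ where
    vertex : ∀ {x} → IsCycle (x ∷ [])
    edge   : ∀ {x y} → Adj x y → IsCycle (x ∷ y ∷ [])
    cycle  : ∀ {x xs} → 2 ≤ length xs → Unique (x ∷ xs) →
             Linked Adj (x ∷ xs ∷ʳ x) → IsCycle (x ∷ xs)

  IsLongestPathOrder : Pred ℕ 0ℓ
  IsLongestPathOrder = Greatest λ k → ∃ λ xs → IsPath xs × length xs ≡ k

  IsLongestCycleOrder : Pred ℕ 0ℓ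
  IsLongestCycleOrder = Greatest λ k → ∃ λ xs → IsCycle xs × length xs ≡ k

  Independent : Pred (Subset order) 0ℓ
  Independent S = ∀ {x y} → x ∈ S → y ∈ S → ¬ Adj x y

  IsIndependenceNumber : Pred ℕ 0ℓ
  IsIndependenceNumber = Greatest λ k → ∃ λ S → Independent S × ∣ S ∣ ≡ k

  NonadjacentDegreeSum : Pred ℕ 0ℓ
  NonadjacentDegreeSum k =
    ∃₂ λ x y → x ≢ y × ¬ Adj x y × degree x + degree y ≡ k

  -- σ₂ takes values in ℕ ∪ {+∞}, with +∞ represented by ⊤⁺.
  data IsSigma₂ : Pred (ℕ ⁺) 0ℓ where
    finite   : ∀ {α s} → IsIndependenceNumber α → 2 ≤ α →
               Least NonadjacentDegreeSum s → IsSigma₂ [ s ]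
    infinite : ∀ {α} → IsIndependenceNumber α → α < 2 → IsSigma₂ ⊤⁺

half : ℕ → ℚᵘ
half k = + k / 2

half∞ : ℕ ⁺ → ℚᵘ ⁺
half∞ [ s ] = [ half s ]
half∞ ⊤⁺    = ⊤⁺

{-# OPTIONS --safe #-}
-- On a longest path x … z every neighbour of an end lies on the path.  If x and
-- z are not adjacent then, since d(x) + d(z) ≥ p, there are consecutive vertices
-- a, b of the path with x ~ b and a ~ z, and x … a z … b x is a cycle.  So the
-- vertices of a longest path can be arranged in a cycle; a vertex v of the cycle
-- with a neighbour outside it would yield a path longer by one (open the cycle
-- at v), so by connectedness the cycle contains all vertices.
module Submission where

open import Defs
open import Data.Fin.Properties using (_≟_)
open import Data.Fin.Subset using (Subset; ⁅_⁆; _∪_; ∣_∣)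
import Data.Fin.Subset as Subset
open import Data.Fin.Subset.Properties
  using (∣⁅x⁆∣≡1; p⊂q⇒∣p∣<∣q∣; p⊆p∪q; q⊆p∪q; x∈⁅x⁆; x∈⁅y⁆⇒x≡y; x∈p∪q⁻)
open import Data.Integer.Base using (+_; pos)
open import Data.Integer.Properties using (drop‿+≤+; *-cancelʳ-≤-pos)
open import Data.List.Base using (List; []; _∷_; _∷ʳ_; _++_; reverse; length; filter; allFin)
open import Data.List.Properties using (unfold-reverse; length-tabulate; filter-reject)
open import Data.List.Membership.Propositional using (_∈_)
open import Data.List.Membership.Propositional.Properties
  using (∈-∃++; ∈-allFin; ∈-filter⁺; ∈-filter⁻)
open import Data.List.Relation.Binary.Permutation.Propositional
  using (_↭_; ↭-refl; ↭-sym; ↭-trans; ↭-reflexive; ↭⇒↭ₛ)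
open import Data.List.Relation.Binary.Permutation.Propositional.Properties
  using (∈-resp-↭; ↭-length; ↭-reverse; shift; ++-comm; ++⁺ˡ)
import Data.List.Relation.Binary.Permutation.Setoid.Properties as Permutation
open import Data.List.Relation.Unary.All as All using ([]; _∷_)
open import Data.List.Relation.Unary.All.Properties using (¬Any⇒All¬)
open import Data.List.Relation.Unary.Any using (here; there)
open import Data.List.Relation.Unary.AllPairs using ([]; _∷_)
open import Data.List.Relation.Unary.Linked using (Linked; []; [-]; _∷_)
open import Data.List.Relation.Unary.Unique.Propositional using (Unique)
open import Data.List.Relation.Unary.Unique.Propositional.Properties using (allFin⁺; filter⁺)
open import Data.Nat.Base using (ℕ; suc; _+_; _≤_; _<_; z≤n; s≤s)
open import Data.Nat.Properties
  using (≤-refl; ≤-reflexive; ≤-trans; ≤-antisym; <⇒≱; +-mono-≤; +-suc; m≤n⇒m≤1+n)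
open import Data.Product.Base using (∃; ∃₂; _×_; _,_; proj₁; proj₂)
open import Data.Rational.Unnormalised.Properties using (drop-*≤*)
open import Data.Sum.Base using (_⊎_; inj₁; inj₂)
open import Level using (0ℓ)
open import Relation.Binary.Construct.Closure.ReflexiveTransitive using (Star; ε; _◅_)
import Relation.Binary.Construct.Add.Supremum.NonStrict as Supremum
open import Relation.Binary.Core using (Rel)
open import Relation.Binary.Definitions using (Symmetric)
open import Relation.Binary.PropositionalEquality.Core
  using (_≡_; _≢_; refl; sym; trans; cong; subst)
open import Relation.Binary.PropositionalEquality.Properties using (setoid)
open import Relation.Nullary.Construct.Add.Supremum using (_⁺; [_])
open import Relation.Nullary.Decidable.Core using (yes; no)
open import Relation.Nullary.Negation.Core using (¬_; contradiction)
open import Relation.Unary using (Pred; Decidable)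

Unique-resp-↭ : {A : Set} {xs ys : List A} → xs ↭ ys → Unique xs → Unique ys
Unique-resp-↭ p = Permutation.Unique-resp-↭ (setoid _) (↭⇒↭ₛ p)

-- Pigeonhole: delete from `ys` an occurrence of the head `x`; the tail of `xs` never needs it,
-- since `x` does not recur there. Serves both to bound degrees and to compare `p` with the order of
-- the graph.
Unique∧⊆⇒length≤ : {A : Set} {xs ys : List A} → Unique xs →
                   (∀ {v} → v ∈ xs → v ∈ ys) → length xs ≤ length ys
Unique∧⊆⇒length≤ {xs = []}     _          _     = z≤n
Unique∧⊆⇒length≤ {xs = x ∷ xs} (x∉ ∷ uxs) xs⊆ys
  with as , bs , refl ← ∈-∃++ (xs⊆ys (here refl)) =
  ≤-trans (s≤s (Unique∧⊆⇒length≤ uxs xs⊆rest)) (≤-reflexive (sym (↭-length (shift x as bs))))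
  where
  xs⊆rest : ∀ {v} → v ∈ xs → v ∈ as ++ bs
  xs⊆rest v∈xs with ∈-resp-↭ (shift x as bs) (xs⊆ys (there v∈xs))
  ... | here refl  = contradiction refl (All.lookup x∉ v∈xs)
  ... | there v∈   = v∈

-- Walk x vs z: the list vs of all visited vertices, from x to z inclusive.
data Walk {A : Set} (R : Rel A 0ℓ) : A → List A → A → Set where
  [-] : ∀ {x} → Walk R x (x ∷ []) x
  _∷_ : ∀ {x y ys z} → R x y → Walk R y ys z → Walk R x (x ∷ ys) z

module _ {A : Set} {R : Rel A 0ℓ} where

  fromLinked : ∀ {x xs} → Linked R (x ∷ xs) → ∃ (Walk R x (x ∷ xs))
  fromLinked [-]     = _ , [-]
  fromLinked (r ∷ l) = let z , w = fromLinked l in z , r ∷ w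

  toLinked : ∀ {x vs z} → Walk R x vs z → Linked R vs
  toLinked [-]            = [-]
  toLinked (r ∷ [-])      = r ∷ [-]
  toLinked (r ∷ (s ∷ w))  = r ∷ toLinked (s ∷ w)

  head-∷ : ∀ {x vs z} → Walk R x vs z → ∃ λ xs → vs ≡ x ∷ xs
  head-∷ [-]     = _ , refl
  head-∷ (_ ∷ _) = _ , refl

  last-∈ : ∀ {x vs z} → Walk R x vs z → z ∈ vs
  last-∈ [-]     = here refl
  last-∈ (_ ∷ w) = there (last-∈ w)

  join : ∀ {x as a b bs z} → Walk R x as a → R a b → Walk R b bs z → Walk R x (as ++ bs) z
  join [-]     r w = r ∷ w
  join (q ∷ v) r w = q ∷ join v r w

  reverseWalk : Symmetric R → ∀ {x vs z} → Walk R x vs z → Walk R z (reverse vs) x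
  reverseWalk s [-] = [-]
  reverseWalk s (_∷_ {x} {ys = ys} r w) rewrite unfold-reverse x ys =
    join (reverseWalk s w) (s r) [-]

  -- The cut is made just before `v`. The case `x ≡ v` stands apart because the first piece would
  -- then be empty, and a walk has at least one vertex.
  splitAt : ∀ {x vs z v} → Walk R x vs z → v ∈ vs →
            x ≡ v ⊎ (∃₂ λ as bs → ∃ λ a → Walk R x as a × Walk R v bs z × vs ≡ as ++ bs)
  splitAt [-]     (here refl) = inj₁ refl
  splitAt (_ ∷ _) (here refl) = inj₁ refl
  splitAt (_∷_ {x} r w) (there v∈) with splitAt w v∈
  ... | inj₁ refl                       = inj₂ (x ∷ [] , _ , x , [-] , w , refl)
  ... | inj₂ (as , bs , a , u , t , refl) = inj₂ (x ∷ as , bs , a , r ∷ u , t , refl)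

  -- Charge each vertex counted by P to the edge entering it and each one counted
  -- by Q to the edge leaving it; without a crossing no edge is charged twice.
  crossing : ∀ {P Q : Pred A 0ℓ} (P? : Decidable P) (Q? : Decidable Q) →
             ∀ {x xs z} → Walk R x (x ∷ xs) z → ¬ Q z →
             (∃₂ λ as bs → ∃₂ λ a b → Walk R x as a × Walk R b bs z × Q a × P b × x ∷ xs ≡ as ++ bs) ⊎
             (length (filter P? xs) + length (filter Q? (x ∷ xs)) ≤ length xs)
  -- No edge enters the head, so P is counted on `xs` alone; no edge leaves the last vertex, so that
  -- one must fail Q.
  crossing P? Q? {z = z} [-] ¬Qz rewrite filter-reject Q? {xs = []} ¬Qz = inj₂ z≤n
  crossing P? Q? {x} (_∷_ {y = y} r w) ¬Qz with head-∷ w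
  ... | ys , refl with crossing P? Q? w ¬Qz
  ... | inj₁ (as , bs , a , b , u , t , q , p , eq) =
    inj₁ (x ∷ as , bs , a , b , r ∷ u , t , q , p , cong (x ∷_) eq)
  -- The one new edge, from `x` to `y`, can be charged only by P at `y` or by Q at `x`; both
  -- together make it a crossing.
  ... | inj₂ ih with P? y | Q? x
  ... | yes p | yes q = inj₁ (x ∷ [] , _ , x , y , [-] , w , q , p , refl)
  ... | yes p | no ¬q = inj₂ (s≤s ih)
  ... | no ¬p | yes q = inj₂ (≤-trans (≤-reflexive (+-suc _ _)) (s≤s ih))
  ... | no ¬p | no ¬q = inj₂ (m≤n⇒m≤1+n ih)

Linked-∷ʳ⁻ : {A : Set} {R : Rel A 0ℓ} (xs : List A) {y : A} → Linked R (xs ∷ʳ y) → Linked R xs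
Linked-∷ʳ⁻ []           _       = []
Linked-∷ʳ⁻ (x ∷ [])     _       = [-]
Linked-∷ʳ⁻ (x ∷ y ∷ xs) (r ∷ l) = r ∷ Linked-∷ʳ⁻ (y ∷ xs) l

half-cancel-≤ : ∀ {m n} → [ half m ] ≤∞ [ half n ] → m ≤ n
half-cancel-≤ h = drop‿+≤+ (*-cancelʳ-≤-pos _ _ (+ 2) (drop-*≤* (Supremum.[≤]-injective _ h)))

module _ (G : Graph) where
  open Graph G renaming (sym to adj-sym)
  open import Data.List.Membership.DecPropositional (_≟_ {order}) using (_∈?_)

  walk⇒path : ∀ {x vs z} → Walk Adj x vs z → Unique vs → IsPath G vs
  walk⇒path w u with head-∷ w
  ... | _ , refl = path u (toLinked w)

  closedWalk⇒cycle : ∀ {x vs z} → Walk Adj x vs z → Unique vs → Adj z x → IsCycle G vs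
  closedWalk⇒cycle [-]             _ _ = vertex
  closedWalk⇒cycle (r ∷ [-])       _ _ = edge r
  closedWalk⇒cycle w@(_ ∷ (_ ∷ v)) u a with head-∷ v
  ... | _ , refl = cycle (s≤s (s≤s z≤n)) u (toLinked (join w a [-]))

  cycle⇒path : ∀ {vs} → IsCycle G vs → IsPath G vs
  cycle⇒path vertex             = path ([] ∷ []) [-]
  cycle⇒path (edge a)           = path (((λ e → irrefl e a) ∷ []) ∷ [] ∷ []) (a ∷ [-])
  cycle⇒path (cycle {x} {xs} _ u l) = path u (Linked-∷ʳ⁻ (x ∷ xs) l)

  -- The two vertices form an independent set. Hence a nonadjacent pair excludes the value +∞ of σ₂.
  nonadjacent⇒2≤α : ∀ {α x y} → IsIndependenceNumber G α → x ≢ y → ¬ Adj x y → 2 ≤ α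
  nonadjacent⇒2≤α {α} {x} {y} (_ , max) x≢y ¬xy =
    ≤-trans 2≤∣S∣ (max (S , independent , refl))
    where
    S : Subset order
    S = ⁅ x ⁆ ∪ ⁅ y ⁆

    ends : ∀ {v} → v Subset.∈ S → v ≡ x ⊎ v ≡ y
    ends v∈ with x∈p∪q⁻ ⁅ x ⁆ ⁅ y ⁆ v∈
    ... | inj₁ v∈x = inj₁ (x∈⁅y⁆⇒x≡y x v∈x)
    ... | inj₂ v∈y = inj₂ (x∈⁅y⁆⇒x≡y y v∈y)

    independent : Independent G S
    independent u∈ v∈ with ends u∈ | ends v∈
    ... | inj₁ refl | inj₁ refl = irrefl refl
    ... | inj₁ refl | inj₂ refl = ¬xy
    ... | inj₂ refl | inj₁ refl = λ a → ¬xy (adj-sym a)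
    ... | inj₂ refl | inj₂ refl = irrefl refl

    2≤∣S∣ : 2 ≤ ∣ S ∣
    -- `S` properly contains the singleton of `x`, because `y` is in it.
    2≤∣S∣ = subst (_< ∣ S ∣) (∣⁅x⁆∣≡1 x)
      (p⊂q⇒∣p∣<∣q∣ (p⊆p∪q ⁅ y ⁆ , y , q⊆p∪q ⁅ x ⁆ ⁅ y ⁆ (x∈⁅x⁆ y) ,
                    λ y∈ → x≢y (sym (x∈⁅y⁆⇒x≡y x y∈))))

  -- Turns the hypothesis into an Ore-type degree condition, with `p` in the place of the number of
  -- vertices.
  σ₂-bound : ∀ {σ₂ p} → IsSigma₂ G σ₂ → [ half p ] ≤∞ half∞ σ₂ →
             ∀ {x y} → x ≢ y → ¬ Adj x y → p ≤ degree G x + degree G y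
  σ₂-bound (finite _ _ (_ , least)) h x≢y ¬xy =
    ≤-trans (half-cancel-≤ h) (least (_ , _ , x≢y , ¬xy , refl))
  σ₂-bound (infinite isα α<2) _ x≢y ¬xy =
    contradiction (nonadjacent⇒2≤α isα x≢y ¬xy) (<⇒≱ α<2)

  module _ {p : ℕ} (longest : IsLongestPathOrder G p) where

    -- A neighbour off the path could be put in front of `x`, giving a path of order `p + 1`.
    neighbour-∈ : ∀ {x vs z w} → Walk Adj x vs z → Unique vs → length vs ≡ p → Adj x w → w ∈ vs
    neighbour-∈ {vs = vs} {w = w} walk u refl a with w ∈? vs
    ... | yes w∈ = w∈
    ... | no  w∉ = contradiction
      (proj₂ longest (_ , walk⇒path (adj-sym a ∷ walk) (¬Any⇒All¬ vs w∉ ∷ u) , refl))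
      (<⇒≱ ≤-refl)

    -- All neighbours of `x` are on the path. Counting them in any rearrangement `us` lets the
    -- degrees of both ends be read off the same list.
    degree-≤ : ∀ {x vs z} → Walk Adj x vs z → Unique vs → length vs ≡ p →
               ∀ {us} → us ↭ vs → degree G x ≤ length (filter (adj? x) us)
    degree-≤ {x} walk u eq us↭vs =
      Unique∧⊆⇒length≤ (filter⁺ (adj? x) (allFin⁺ order)) λ v∈ →
        let a = proj₂ (∈-filter⁻ (adj? x) {xs = allFin order} v∈)
        in ∈-filter⁺ (adj? x) (∈-resp-↭ (↭-sym us↭vs) (neighbour-∈ walk u eq a)) a

    -- A one-vertex path has no closing edge, as there are no loops, and so needs its own
    -- alternative.
    LongestClosedPath : Set
    LongestClosedPath = ∃₂ λ x vs → ∃ λ z →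
      Walk Adj x vs z × Unique vs × length vs ≡ p × (vs ≡ x ∷ [] ⊎ Adj z x)

    closePath : (∀ {x y} → x ≢ y → ¬ Adj x y → p ≤ degree G x + degree G y) → LongestClosedPath
    closePath ore with proj₁ longest
    ... | x ∷ xs , path u l , eq with fromLinked l
    ... | z , w with adj? z x
    ... | yes zx = x , _ , z , w , u , eq , inj₂ zx
    ... | no ¬zx with x ≟ z
    -- Equal ends leave only the one-vertex walk; in a longer one `x` would occur twice.
    closePath ore | _ ∷ _ , path u l , eq | z , w | no ¬zx | yes refl with w | u
    ... | [-]    | _      = _ , _ , _ , w , u , eq , inj₁ refl
    ... | _ ∷ w′ | x∉ ∷ _ = contradiction refl (All.lookup x∉ (last-∈ w′))
    closePath ore | x ∷ xs , path u l , eq | z , w | no ¬zx | no x≢z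
      with crossing (adj? x) (adj? z) w (irrefl refl)
    -- The new walk runs from `b` to `z`, jumps to `a` and returns to `x`; the edge between `x` and
    -- `b` closes it.
    ... | inj₁ (as , bs , a , b , v , t , za , xb , split) =
      b , bs ++ reverse as , x , join t za (reverseWalk adj-sym v) ,
      Unique-resp-↭ (↭-sym rearranged) u , trans (↭-length rearranged) eq , inj₂ xb
      where
      rearranged : bs ++ reverse as ↭ x ∷ xs
      rearranged = ↭-trans (++⁺ˡ bs (↭-reverse as))
                     (↭-trans (++-comm bs as) (↭-reflexive (sym split)))
    -- Without a crossing the two degrees add up to at most `length xs`, the number `p - 1` of edges
    -- of the path.
    ... | inj₂ few = contradiction (ore x≢z (λ a → ¬zx (adj-sym a))) (<⇒≱ degrees<p)
      where
      degree-x : degree G x ≤ length (filter (adj? x) xs)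
      degree-x = ≤-trans (degree-≤ w u eq ↭-refl)
        (≤-reflexive (cong length (filter-reject (adj? x) (irrefl refl))))

      reversed : reverse (x ∷ xs) ↭ x ∷ xs
      reversed = ↭-reverse (x ∷ xs)

      degree-z : degree G z ≤ length (filter (adj? z) (x ∷ xs))
      degree-z = degree-≤ (reverseWalk adj-sym w) (Unique-resp-↭ (↭-sym reversed) u)
        (trans (↭-length reversed) eq) (↭-sym reversed)

      degrees<p : degree G x + degree G z < p
      degrees<p = ≤-trans (s≤s (≤-trans (+-mono-≤ degree-x degree-z) few)) (≤-reflexive eq)

    module _ {x z : Vertex} {vs : List Vertex}
             (w : Walk Adj x vs z) (u : Unique vs) (eq : length vs ≡ p) where

      closed⇒cycle : vs ≡ x ∷ [] ⊎ Adj z x → IsCycle G vs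
      closed⇒cycle (inj₁ refl) = vertex
      closed⇒cycle (inj₂ zx)   = closedWalk⇒cycle w u zx

      neighbour-closed : vs ≡ x ∷ [] ⊎ Adj z x → ∀ {v y} → v ∈ vs → Adj v y → y ∈ vs
      neighbour-closed (inj₁ refl) (here refl) vy = neighbour-∈ w u eq vy
      neighbour-closed (inj₂ zx) v∈ vy with splitAt w v∈
      ... | inj₁ refl = neighbour-∈ w u eq vy
      -- Swapping the two pieces, joined by the closing edge, gives a longest path that starts at
      -- `v`.
      ... | inj₂ (as , bs , _ , s , t , split) =
        ∈-resp-↭ rotated (neighbour-∈ (join t zx s) (Unique-resp-↭ (↭-sym rotated) u)
          (trans (↭-length rotated) eq) vy)
        where
        rotated : bs ++ as ↭ vs
        rotated = ↭-trans (++-comm bs as) (↭-reflexive (sym split))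

      star-closed : vs ≡ x ∷ [] ⊎ Adj z x → ∀ {v y} → v ∈ vs → Star Adj v y → y ∈ vs
      star-closed closed v∈ ε       = v∈
      star-closed closed v∈ (a ◅ s) = star-closed closed (neighbour-closed closed v∈ a) s

      spanning : vs ≡ x ∷ [] ⊎ Adj z x → Connected G → p ≡ order
      spanning closed (_ , connected) = trans (sym eq) (trans
        -- `vs` and the list of all vertices are both free of repetitions and contain each other.
        (≤-antisym (Unique∧⊆⇒length≤ u (λ _ → ∈-allFin _))
                   (Unique∧⊆⇒length≤ (allFin⁺ order)
                     (λ _ → star-closed closed (last-∈ w) (connected z _))))
        (length-tabulate {n = order} (λ v → v)))

theorem1 : (G : Graph) → Connected G →
    (p c : ℕ) (σ₂ : ℕ ⁺) →
    IsLongestPathOrder G p → IsLongestCycleOrder G c → IsSigma₂ G σ₂ →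
    [ half p ] ≤∞ half∞ σ₂ →
    c ≡ p × p ≡ Graph.order G
theorem1 G conn p c σ₂ longestPath ((cs , isCycle , refl) , longestCycle) isσ₂ h
  with _ , vs , _ , w , u , eq , closed ← closePath G longestPath (σ₂-bound G isσ₂ h) =
  -- `c ≤ p` because a cycle without its closing edge is a path; `p ≤ c` because the closed longest
  -- path is a cycle.
  ≤-antisym (proj₂ longestPath (cs , cycle⇒path G isCycle , refl))
            (longestCycle (vs , closed⇒cycle G longestPath w u eq closed , eq)) ,
  spanning G longestPath w u eq closed conn
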